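{- For $k \ge 2$ and a positive integer $n \equiv 0 \pmod 6$, let $F_1, F_2, \ldots, F_k$ be graphs on a common set of $n$ vertices, each of which is isomorphic to a cycle $C_n$. Then \[ \gamma_{\rm sd}(F_1,F_2,\ldots,F_k) \le \left( 1 - \frac{1}{2} \left( \frac{2}{3} \right)^{k-2} \right) n. \]
   Context: All graphs are finite and simple; $C_n$ is the cycle on $n$ vertices. Given graphs $F_1,\ldots,F_k$ (called factors; not necessarily edge-disjoint) with common vertex set $V$, a set $S \subseteq V$ is a simultaneous dominating set if for every $i$, $1 \le i \le k$, every vertex not in $S$ is adjacent in $F_i$ to some vertex of $S$. The simultaneous domination number $\gamma_{\rm sd}(F_1,\ldots,F_k)$ is the minimum cardinality of a simultaneous dominating set. -}

module Defs where

import Algebra.Definitions.RawSemiring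
open import Data.Fin using (Fin; toℕ)
open import Data.Fin.Permutation using (Permutation′; _⟨$⟩ʳ_)
open import Data.Fin.Properties using (_≟_; all?; any?)
open import Data.Fin.Subset using (Subset; _∈_; _∉_; ∣_∣; ⊤)
open import Data.Fin.Subset.Properties using (_∈?_; ∈⊤; anySubset?)
open import Data.Integer using (+_)
open import Data.Nat as ℕ using (ℕ; suc; NonZero; _%_; _≤_; _<_; _<?_)
open import Data.Nat.Induction using (<-wellFounded)
open import Data.Nat.Properties using (≮⇒≥)
open import Data.Product using (∃; _×_; _,_; proj₁)
open import Data.Rational as ℚ using (ℚ; +-*-rawSemiring)
open import Data.Sum using (_⊎_; swap)
open import Function using (_∘_; _⇔_)
open import Induction.WellFounded using (Acc; acc)
open import Level using (0ℓ)
open import Relation.Binary using (Rel; Decidable; Symmetric; Irreflexive)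
open import Relation.Binary.PropositionalEquality using (_≡_; _≢_; refl; sym)
open import Relation.Nullary using (yes; no; contradiction)
open import Relation.Nullary.Decidable using (¬?; _×-dec_; _⊎-dec_; _→-dec_)
import Relation.Unary as U

open Algebra.Definitions.RawSemiring +-*-rawSemiring public using (_^_)

record Graph (n : ℕ) : Set₁ where
  field
    Adj    : Rel (Fin n) 0ℓ
    Adj?   : Decidable Adj
    symm   : Symmetric Adj
    irrefl : Irreflexive _≡_ Adj

open Graph public

record _≅_ {n : ℕ} (G H : Graph n) : Set where
  field
    bij      : Permutation′ n
    preserve : ∀ u v → Adj G u v ⇔ Adj H (bij ⟨$⟩ʳ u) (bij ⟨$⟩ʳ v)

infix 4 _≅_

Next : (n : ℕ) .{{_ : NonZero n}} → Rel (Fin n) 0ℓ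
Next n u v = suc (toℕ u) % n ≡ toℕ v

-- The condition u ≢ v matters only for n = 1, where it excludes a loop.
-- For n ≥ 3 this is the usual cycle on n vertices.
C : (n : ℕ) .{{_ : NonZero n}} → Graph n
C n = record
  { Adj    = λ u v → u ≢ v × (Next n u v ⊎ Next n v u)
  ; Adj?   = λ u v → ¬? (u ≟ v)
                       ×-dec ((suc (toℕ u) % n ℕ.≟ toℕ v)
                               ⊎-dec (suc (toℕ v) % n ℕ.≟ toℕ u))
  ; symm   = λ (u≢v , e) → u≢v ∘ sym , swap e
  ; irrefl = λ u≡v (u≢v , _) → contradiction u≡v u≢v
  }

module _ {k n : ℕ} (F : Fin k → Graph n) where

  SimDominating : Subset n → Set
  SimDominating S = ∀ i v → v ∉ S → ∃ λ u → u ∈ S × Adj (F i) v u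

  simDominating? : U.Decidable SimDominating
  simDominating? S = all? λ i → all? λ v →
    ¬? (v ∈? S) →-dec any? λ u → (u ∈? S) ×-dec Adj? (F i) v u

  ⊤-simDominating : SimDominating ⊤
  ⊤-simDominating i v v∉⊤ = contradiction ∈⊤ v∉⊤

MinCard : {n : ℕ} → (Subset n → Set) → ℕ → Set
MinCard P m = (∃ λ S → P S × ∣ S ∣ ≡ m) × (∀ S → P S → m ≤ ∣ S ∣)

minCard : {n : ℕ} {P : Subset n → Set} → U.Decidable P →
          ∃ P → ∃ (MinCard P)
minCard {P = P} P? (S , PS) = go S PS (<-wellFounded ∣ S ∣)
  where
  go : ∀ S → P S → Acc _<_ ∣ S ∣ → ∃ (MinCard P)
  go S PS (acc rs) with anySubset? (λ T → P? T ×-dec (∣ T ∣ <? ∣ S ∣))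
  ... | yes (T , PT , T<S) = go T PT (rs T<S)
  ... | no  none           =
    ∣ S ∣ , (S , PS , refl) , λ T PT → ≮⇒≥ λ T<S → none (T , PT , T<S)

simDomNumber : {k n : ℕ} (F : Fin k → Graph n) → ∃ (MinCard (SimDominating F))
simDomNumber F = minCard (simDominating? F) (⊤ , ⊤-simDominating F)

γsd : {k n : ℕ} → (Fin k → Graph n) → ℕ
γsd F = proj₁ (simDomNumber F)

fromℕ : ℕ → ℚ
fromℕ n = + n ℚ./ 1

-- Pass to complements: S dominates F simultaneously iff every vertex of D = ∁ S has, in each factor,
-- a neighbour outside D, and this property is inherited by subsets of D.  For k = 2 take a perfect
-- matching of each cycle.  The union of the two matchings is bipartite, and either colour class is
-- a valid D, so some D has at least n / 2 vertices.  For each further cycle, label its vertices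
-- consecutively mod 3: deleting from D any one residue class makes D valid for that cycle, because every
-- vertex of another class has a neighbour in the deleted one.  The best choice keeps at least 2/3 of D.
module Submission where

open import Defs
open import Algebra.Bundles using (CommutativeMonoid)
import Algebra.Properties.CommutativeSemigroup
open import Data.Bool using (Bool; true; false; not)
open import Data.Fin using (Fin; zero; suc; toℕ)
open import Data.Fin.Patterns using (0F; 1F; 2F)
open import Data.Fin.Permutation using (_⟨$⟩ʳ_; _⟨$⟩ˡ_; inverseˡ; inverseʳ)
open import Data.Fin.Properties
  using (_≟_; toℕ-injective; toℕ-fromℕ<; toℕ<n; pigeonhole; ∀-cons)
open import Data.Fin.Subset using (Subset; _∈_; _∉_; _⊆_; ∣_∣; ∁; _∩_)
open import Data.Fin.Subset.Properties
  using (∣∁p∣≡n∸∣p∣; p∩q⊆p; x∈p∩q⁻; x∈∁p⇒x∉p; x∉p⇒x∈∁p; x∉∁p⇒x∈p; ∣p∣≤n)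
open import Data.Integer using (+_; +≤+)
import Data.Integer as ℤ
import Data.Integer.Properties as ℤ
open import Data.Nat using (ℕ; zero; suc; z≤n; s≤s; NonZero; _∸_; _<?_) renaming (_≤_ to _≤ℕ_)
import Data.Nat as ℕ
open import Data.Nat.Divisibility using (_∣_; divides; ∣-trans)
open import Data.Nat.DivMod hiding (_/_)
open import Data.Nat.GeneralisedArithmetic using (fold; fold-+)
import Data.Nat.Properties as ℕ
open import Data.Product using (∃; _×_; _,_; proj₁; proj₂)
open import Data.Rational using (ℚ; 1ℚ; ½; _/_; _+_; _*_; _-_; -_; _≤_; toℚᵘ)
import Data.Rational.Properties as ℚ
import Data.Rational.Unnormalised as ℚᵘ
import Data.Rational.Unnormalised.Properties as ℚᵘ
open import Data.Sum using (_⊎_; inj₁; inj₂)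
open import Data.Vec using (tabulate; []; _∷_)
open import Data.Vec.Properties using (lookup∘tabulate; []=⇒lookup; lookup⇒[]=; tabulate-∘)
open import Function using (_∘_; Equivalence)
open import Function.Definitions using (Injective)
open import Relation.Binary using (tri<; tri≈; tri>)
open import Relation.Binary.PropositionalEquality
open import Relation.Nullary using (does; contradiction)
open import Relation.Nullary.Decidable using (dec-true; dec-false)

-- Orbits of an injection

argmin-≤ : (g : ℕ → ℕ) (d : ℕ) → ∃ λ i → ∀ j → j ≤ℕ d → g i ≤ℕ g j
argmin-≤ g zero = 0 , λ where _ z≤n → ℕ.≤-refl
argmin-≤ g (suc d) with argmin-≤ g d
... | i , i-min with ℕ.≤-total (g i) (g (suc d))
...   | inj₁ gi≤ = i , λ j j≤1+d → case-≤ j (ℕ.m≤n⇒m<n∨m≡n j≤1+d)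
  where
  case-≤ : ∀ j → j ℕ.< suc d ⊎ j ≡ suc d → g i ≤ℕ g j
  case-≤ j (inj₁ j<1+d) = i-min j (ℕ.≤-pred j<1+d)
  case-≤ j (inj₂ refl)  = gi≤
...   | inj₂ ≤gi = suc d , λ j j≤1+d → case-≤ j (ℕ.m≤n⇒m<n∨m≡n j≤1+d)
  where
  case-≤ : ∀ j → j ℕ.< suc d ⊎ j ≡ suc d → g (suc d) ≤ℕ g j
  case-≤ j (inj₁ j<1+d) = ℕ.≤-trans ≤gi (i-min j (ℕ.≤-pred j<1+d))
  case-≤ j (inj₂ refl)  = ℕ.≤-refl

fold-suc : ∀ {A : Set} (f : A → A) v j → fold (f v) f j ≡ f (fold v f j)
fold-suc f v zero    = refl
fold-suc f v (suc j) = cong f (fold-suc f v j)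

module Orbit {n : ℕ} (f : Fin n → Fin n) (f-inj : Injective _≡_ _≡_ f) where

  fold-cancel : ∀ v i j → fold v f i ≡ fold v f (i ℕ.+ j) → v ≡ fold v f j
  fold-cancel v zero    j eq = eq
  fold-cancel v (suc i) j eq = fold-cancel v i j (f-inj eq)

  -- Among the iterates with exponents 0 to `n` two coincide, and injectivity cancels the smaller
  -- exponent. Writing the difference as `suc d` keeps the period positive.
  period : ∀ v → ∃ λ d → fold v f (suc d) ≡ v
  period v with pigeonhole (ℕ.n<1+n n) (λ j → fold v f (toℕ j))
  ... | i , j , i<j , eq with ℕ.m≤n⇒∃[o]m+o≡n i<j
  ... | d , i+d≡j = d , sym (fold-cancel v (toℕ i) (suc d)
          (trans eq (cong (fold v f) (trans (sym i+d≡j) (sym (ℕ.+-suc (toℕ i) d))))))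

  fold-multiple : ∀ v d → fold v f d ≡ v → ∀ q → fold v f (q ℕ.* d) ≡ v
  fold-multiple v d eq zero    = refl
  fold-multiple v d eq (suc q) =
    trans (fold-+ v f d) (trans (cong (λ z → fold z f d) (fold-multiple v d eq q)) eq)

  fold-% : ∀ v d → fold v f (suc d) ≡ v → ∀ j → fold v f j ≡ fold v f (j % suc d)
  fold-% v d eq j = begin
    fold v f j                                              ≡⟨ cong (fold v f) (m≡m%n+[m/n]*n j (suc d)) ⟩
    fold v f (j % suc d ℕ.+ q)                              ≡⟨ fold-+ v f (j % suc d) ⟩
    fold (fold v f q) f (j % suc d)                         ≡⟨ cong (λ z → fold z f (j % suc d)) (fold-multiple v (suc d) eq (j ℕ./ suc d)) ⟩
    fold v f (j % suc d)                                    ∎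
    where
    open ≡-Reasoning
    q = j ℕ./ suc d ℕ.* suc d

  abstract
    -- Exponents reduce modulo the period, so a minimum over finitely many iterates is a minimum
    -- over all of them.
    orbitMin : ∀ v → ∃ λ i → ∀ j → toℕ (fold v f i) ≤ℕ toℕ (fold v f j)
    orbitMin v with period v
    ... | d , eq with argmin-≤ (λ j → toℕ (fold v f j)) d
    ... | i , i-min = i , λ j → subst (λ w → toℕ (fold v f i) ≤ℕ toℕ w) (sym (fold-% v d eq j))
                                  (i-min (j % suc d) (ℕ.≤-pred (m%n<n j (suc d))))

  -- A label of the orbit of `v`. Being a natural number, it makes two orbits comparable, which
  -- `colour` exploits.
  least : Fin n → ℕ
  least v = toℕ (fold v f (proj₁ (orbitMin v)))

  -- The iterates of `f v` return to `v` after `d` steps, so each of the two orbits contains the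
  -- other.
  least-f : ∀ v → least (f v) ≡ least v
  least-f v with period v
  ... | d , eq = ℕ.≤-antisym f≤ ≤f
    where
    i = proj₁ (orbitMin v)
    j = proj₁ (orbitMin (f v))

    back : fold (f v) f d ≡ v
    back = trans (fold-suc f v d) eq

    f≤ : least (f v) ≤ℕ least v
    f≤ = subst (λ w → least (f v) ≤ℕ toℕ w)
           (trans (fold-+ (f v) f i) (cong (λ z → fold z f i) back))
           (proj₂ (orbitMin (f v)) (i ℕ.+ d))

    ≤f : least v ≤ℕ least (f v)
    ≤f = subst (λ w → least v ≤ℕ toℕ w) (sym (fold-suc f v j)) (proj₂ (orbitMin v) (suc j))

-- The union of two perfect matchings is bipartite

module TwoMatchings {n : ℕ} (a b : Fin n → Fin n)
  (a-invol : ∀ v → a (a v) ≡ v) (b-invol : ∀ v → b (b v) ≡ v)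
  (a-free : ∀ v → a v ≢ v) (b-free : ∀ v → b v ≢ v) where

  -- Two steps of the walk that alternates between `a` and `b`. On each component of the union of
  -- the matchings, the orbits of `p` are the two sides of the bipartition.
  p : Fin n → Fin n
  p v = b (a v)

  p-inj : Injective _≡_ _≡_ p
  p-inj {x} {y} eq = trans (sym (a-invol x)) (trans (cong a ax≡ay) (a-invol y))
    where
    ax≡ay : a x ≡ a y
    ax≡ay = trans (sym (b-invol (a x))) (trans (cong b eq) (b-invol (a y)))

  open Orbit p p-inj

  -- a conjugates p to its inverse, so p^(t+2) x ≡ a x gives p^t (p x) ≡ a (p x); descending by two,
  -- one ends at a fixed point of a or of b.
  fold≢a : ∀ t x → fold x p t ≢ a x
  fold≢a zero          x eq = a-free x (sym eq)
  fold≢a (suc zero)    x eq = b-free (a x) eq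
  fold≢a (suc (suc t)) x eq = fold≢a t (p x) (begin
    fold (p x) p t             ≡⟨ fold-suc p x t ⟩
    fold x p (suc t)           ≡⟨ a-invol _ ⟨
    a (a (fold x p (suc t)))   ≡⟨ cong a (b-invol _) ⟨
    a (b (fold x p (2 ℕ.+ t))) ≡⟨ cong (a ∘ b) eq ⟩
    a (p x)                    ∎)
    where open ≡-Reasoning

  -- Applying `a` reverses `p`: if `w` is the preimage of `v` under `p`, then `p (a v)` equals
  -- `a w`. Each induction step thus moves one application of `p` from the right side to the left,
  -- until `fold≢a` applies.
  fold≢fold-a : ∀ i j v → fold v p i ≢ fold (a v) p j
  fold≢fold-a i zero    v eq = fold≢a i v eq
  fold≢fold-a i (suc j) v eq = fold≢fold-a (suc i) j w (begin
    p (fold w p i)     ≡⟨ fold-suc p w i ⟨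
    fold (p w) p i     ≡⟨ cong (λ z → fold z p i) pw≡v ⟩
    fold v p i         ≡⟨ eq ⟩
    p (fold (a v) p j) ≡⟨ fold-suc p (a v) j ⟨
    fold (p (a v)) p j ≡⟨ cong (λ z → fold (b z) p j) (a-invol v) ⟩
    fold (b v) p j     ≡⟨ cong (λ z → fold z p j) (a-invol (b v)) ⟨
    fold (a w) p j     ∎)
    where
    open ≡-Reasoning
    w = a (b v)
    pw≡v : p w ≡ v
    pw≡v = trans (cong b (a-invol (b v))) (b-invol v)

  -- Labels are attained, so equal labels would give a vertex common to both orbits.
  least-a : ∀ v → least v ≢ least (a v)
  least-a v eq = fold≢fold-a (proj₁ (orbitMin v)) (proj₁ (orbitMin (a v))) v (toℕ-injective eq)

  -- As `a` is an involution, `b v` is `p (a v)`.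
  least-b : ∀ v → least (b v) ≡ least (a v)
  least-b v = trans (cong (least ∘ b) (sym (a-invol v))) (least-f (a v))

  -- Here `a (b v)` is the preimage of `v` under `p`.
  least-ab : ∀ v → least (a (b v)) ≡ least v
  least-ab v = trans (sym (least-f (a (b v)))) (cong least (trans (cong b (a-invol (b v))) (b-invol v)))

  -- Both a and b interchange the p-orbit of v with that of a v, and these are distinct.
  colour : Fin n → Bool
  colour v = does (least v <? least (a v))

  does-<?-swap : ∀ {x y} → x ≢ y → does (y <? x) ≡ not (does (x <? y))
  does-<?-swap {x} {y} x≢y with ℕ.<-cmp x y
  ... | tri< x<y _ y≮x = trans (dec-false (y <? x) y≮x) (cong not (sym (dec-true (x <? y) x<y)))
  ... | tri≈ _ x≡y _   = contradiction x≡y x≢y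
  ... | tri> x≮y _ y<x = trans (dec-true (y <? x) y<x) (cong not (sym (dec-false (x <? y) x≮y)))

  colour-a : ∀ v → colour (a v) ≡ not (colour v)
  colour-a v = trans (cong (λ w → does (least (a v) <? least w)) (a-invol v)) (does-<?-swap (least-a v))

  colour-b : ∀ v → colour (b v) ≡ not (colour v)
  colour-b v = trans (cong₂ (λ x y → does (x <? y)) (least-b v) (least-ab v)) (does-<?-swap (least-a v))

-- Subsets of the vertices of a graph

Escapes : ∀ {n} → Graph n → Subset n → Set
Escapes G D = ∀ v → v ∈ D → ∃ λ u → u ∉ D × Adj G v u

Escapes-⊆ : ∀ {n} (G : Graph n) {D E : Subset n} → D ⊆ E → Escapes G E → Escapes G D
Escapes-⊆ G D⊆E esc v v∈D with esc v (D⊆E v∈D)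
... | u , u∉E , v~u = u , u∉E ∘ D⊆E , v~u

∈-tabulate⁺ : ∀ {n} (c : Fin n → Bool) {v} → c v ≡ true → v ∈ tabulate c
∈-tabulate⁺ c {v} eq = lookup⇒[]= v _ (trans (lookup∘tabulate c v) eq)

∈-tabulate⁻ : ∀ {n} (c : Fin n → Bool) {v} → v ∈ tabulate c → c v ≡ true
∈-tabulate⁻ c {v} v∈ = trans (sym (lookup∘tabulate c v)) ([]=⇒lookup v∈)

Escapes-colour : ∀ {n} (G : Graph n) (m : Fin n → Fin n) (c : Fin n → Bool) →
                 (∀ v → Adj G v (m v)) → (∀ v → c (m v) ≡ not (c v)) → Escapes G (tabulate c)
Escapes-colour G m c adj alt v v∈ = m v , mv∉ , adj v
  where
  mv∉ : m v ∉ tabulate c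
  mv∉ mv∈ with trans (sym (∈-tabulate⁻ c mv∈)) (trans (alt v) (cong not (∈-tabulate⁻ c v∈)))
  ... | ()

fibre : ∀ {n} → (Fin n → Fin 3) → Fin 3 → Subset n
fibre c r = tabulate (λ v → does (c v ≟ r))

∈-fibre⁺ : ∀ {n} (c : Fin n → Fin 3) {r v} → c v ≡ r → v ∈ fibre c r
∈-fibre⁺ c {r} {v} eq = ∈-tabulate⁺ (λ w → does (c w ≟ r)) (dec-true (c v ≟ r) eq)

-- Inductive step of the count that follows, with one conjunct for each possible class of the new
-- element.
suc-two-of-three : ∀ {x y z d} → x ℕ.+ y ℕ.+ z ≡ 2 ℕ.* d →
  (x ℕ.+ suc y ℕ.+ suc z ≡ 2 ℕ.* suc d) ×
  (suc x ℕ.+ y ℕ.+ suc z ≡ 2 ℕ.* suc d) ×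
  (suc x ℕ.+ suc y ℕ.+ z ≡ 2 ℕ.* suc d)
suc-two-of-three {x} {y} {z} {d} eq =
  grow (trans (ℕ.+-suc (x ℕ.+ suc y) z) (cong (λ w → suc (w ℕ.+ z)) (ℕ.+-suc x y))) ,
  grow (cong suc (ℕ.+-suc (x ℕ.+ y) z)) ,
  grow (cong (λ w → suc (w ℕ.+ z)) (ℕ.+-suc x y))
  where
  grow : ∀ {s} → s ≡ 2 ℕ.+ (x ℕ.+ y ℕ.+ z) → s ≡ 2 ℕ.* suc d
  grow s≡ = trans s≡ (trans (cong (2 ℕ.+_) eq) (sym (ℕ.*-suc 2 d)))

-- Double counting: each element of `D` lies in one class and survives the deletion of the other
-- two.
∣∩∁fibre∣-sum : ∀ {n} (c : Fin n → Fin 3) (D : Subset n) →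
  let rest = λ r → ∣ D ∩ ∁ (fibre c r) ∣ in rest 0F ℕ.+ rest 1F ℕ.+ rest 2F ≡ 2 ℕ.* ∣ D ∣
∣∩∁fibre∣-sum c []          = refl
∣∩∁fibre∣-sum c (false ∷ D) = ∣∩∁fibre∣-sum (c ∘ suc) D
∣∩∁fibre∣-sum c (true ∷ D) with c 0F | suc-two-of-three (∣∩∁fibre∣-sum (c ∘ suc) D)
... | 0F | eq , _ , _ = eq
... | 1F | _ , eq , _ = eq
... | 2F | _ , _ , eq = eq

+-bound₃ : ∀ {m x y z} → x ≤ℕ m → y ≤ℕ m → z ≤ℕ m → x ℕ.+ y ℕ.+ z ≤ℕ 3 ℕ.* m
+-bound₃ {m} {x} {y} {z} x≤m y≤m z≤m = subst (x ℕ.+ y ℕ.+ z ≤ℕ_) (triple m) (ℕ.+-mono-≤ (ℕ.+-mono-≤ x≤m y≤m) z≤m)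
  where
  triple : ∀ m → m ℕ.+ m ℕ.+ m ≡ 3 ℕ.* m
  triple m = trans (ℕ.+-assoc m m m) (cong (λ x → m ℕ.+ (m ℕ.+ x)) (sym (ℕ.+-identityʳ m)))

sum≤3*max : (f : Fin 3 → ℕ) → ∃ λ r → f 0F ℕ.+ f 1F ℕ.+ f 2F ≤ℕ 3 ℕ.* f r
sum≤3*max f with ℕ.≤-total (f 0F) (f 1F) | ℕ.≤-total (f 1F) (f 2F) | ℕ.≤-total (f 0F) (f 2F)
... | inj₁ 0≤1 | inj₁ 1≤2 | _        = 2F , +-bound₃ (ℕ.≤-trans 0≤1 1≤2) 1≤2 ℕ.≤-refl
... | inj₁ 0≤1 | inj₂ 2≤1 | _        = 1F , +-bound₃ 0≤1 ℕ.≤-refl 2≤1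
... | inj₂ 1≤0 | _        | inj₁ 0≤2 = 2F , +-bound₃ 0≤2 (ℕ.≤-trans 1≤0 0≤2) ℕ.≤-refl
... | inj₂ 1≤0 | _        | inj₂ 2≤0 = 0F , +-bound₃ ℕ.≤-refl 1≤0 2≤0

-- The cycle C n for 6 ∣ n

next₃ : Fin 3 → Fin 3
next₃ r = suc (toℕ r) mod 3

-- Distinct residues modulo 3 differ by 1 or by -1, so class `r` is one step forward or back from
-- any other class.
next₃-cases : ∀ x r → x ≢ r → next₃ x ≡ r ⊎ next₃ r ≡ x
next₃-cases 0F 0F x≢r = contradiction refl x≢r
next₃-cases 0F 1F _   = inj₁ refl
next₃-cases 0F 2F _   = inj₂ refl
next₃-cases 1F 0F _   = inj₂ refl
next₃-cases 1F 1F x≢r = contradiction refl x≢r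
next₃-cases 1F 2F _   = inj₁ refl
next₃-cases 2F 0F _   = inj₁ refl
next₃-cases 2F 1F _   = inj₂ refl
next₃-cases 2F 2F x≢r = contradiction refl x≢r

next₃-injective : ∀ x y → next₃ x ≡ next₃ y → x ≡ y
next₃-injective 0F 0F _ = refl
next₃-injective 0F 1F ()
next₃-injective 0F 2F ()
next₃-injective 1F 0F ()
next₃-injective 1F 1F _ = refl
next₃-injective 1F 2F ()
next₃-injective 2F 0F ()
next₃-injective 2F 1F ()
next₃-injective 2F 2F _ = refl

[m%n+o]%n≡[m+o]%n : ∀ m o n .{{_ : NonZero n}} → (m % n ℕ.+ o) % n ≡ (m ℕ.+ o) % n
[m%n+o]%n≡[m+o]%n m o n = begin
  (m % n ℕ.+ o) % n           ≡⟨ %-distribˡ-+ (m % n) o n ⟩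
  (m % n % n ℕ.+ o % n) % n   ≡⟨ cong (λ x → (x ℕ.+ o % n) % n) (m%n%n≡m%n m n) ⟩
  (m % n ℕ.+ o % n) % n       ≡⟨ %-distribˡ-+ m o n ⟨
  (m ℕ.+ o) % n               ∎
  where open ≡-Reasoning

[1+m%n]%n≡[1+m]%n : ∀ m n .{{_ : NonZero n}} → suc (m % n) % n ≡ suc m % n
[1+m%n]%n≡[1+m]%n m n = begin
  suc (m % n) % n   ≡⟨ cong (_% n) (ℕ.+-comm 1 (m % n)) ⟩
  (m % n ℕ.+ 1) % n ≡⟨ [m%n+o]%n≡[m+o]%n m 1 n ⟩
  (m ℕ.+ 1) % n     ≡⟨ cong (_% n) (ℕ.+-comm m 1) ⟩
  suc m % n         ∎
  where open ≡-Reasoning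

module Cycle (n : ℕ) .{{_ : NonZero n}} where

  next prev : Fin n → Fin n
  next v = suc (toℕ v) mod n
  -- Adding `n - 1` modulo `n` avoids truncated subtraction at vertex 0.
  prev v = (toℕ v ℕ.+ ℕ.pred n) mod n

  toℕ-mod : ∀ m d .{{_ : NonZero d}} → toℕ (m mod d) ≡ m % d
  toℕ-mod m d = toℕ-fromℕ< (m%n<n m d)

  wrap : ∀ v → (suc (toℕ v) ℕ.+ ℕ.pred n) % n ≡ toℕ v
  wrap v = begin
    suc (toℕ v ℕ.+ ℕ.pred n) % n ≡⟨ cong (_% n) (ℕ.+-suc (toℕ v) (ℕ.pred n)) ⟨
    (toℕ v ℕ.+ suc (ℕ.pred n)) % n ≡⟨ cong (λ x → (toℕ v ℕ.+ x) % n) (ℕ.suc-pred n) ⟩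
    (toℕ v ℕ.+ n) % n            ≡⟨ [m+n]%n≡m%n (toℕ v) n ⟩
    toℕ v % n                    ≡⟨ m<n⇒m%n≡m (toℕ<n v) ⟩
    toℕ v                        ∎
    where open ≡-Reasoning

  prev-next : ∀ v → prev (next v) ≡ v
  prev-next v = toℕ-injective (begin
    toℕ (prev (next v))                    ≡⟨ toℕ-mod _ n ⟩
    (toℕ (next v) ℕ.+ ℕ.pred n) % n        ≡⟨ cong (λ x → (x ℕ.+ ℕ.pred n) % n) (toℕ-mod _ n) ⟩
    (suc (toℕ v) % n ℕ.+ ℕ.pred n) % n     ≡⟨ [m%n+o]%n≡[m+o]%n (suc (toℕ v)) (ℕ.pred n) n ⟩
    (suc (toℕ v) ℕ.+ ℕ.pred n) % n         ≡⟨ wrap v ⟩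
    toℕ v                                  ∎)
    where open ≡-Reasoning

  next-prev : ∀ v → next (prev v) ≡ v
  next-prev v = toℕ-injective (begin
    toℕ (next (prev v))                    ≡⟨ toℕ-mod _ n ⟩
    suc (toℕ (prev v)) % n                 ≡⟨ cong (λ x → suc x % n) (toℕ-mod _ n) ⟩
    suc ((toℕ v ℕ.+ ℕ.pred n) % n) % n     ≡⟨ [1+m%n]%n≡[1+m]%n (toℕ v ℕ.+ ℕ.pred n) n ⟩
    suc (toℕ v ℕ.+ ℕ.pred n) % n           ≡⟨ wrap v ⟩
    toℕ v                                  ∎)
    where open ≡-Reasoning

  residue : (d : ℕ) .{{_ : NonZero d}} → Fin n → Fin d
  residue d v = toℕ v mod d

  -- Divisibility makes the wrap from `n - 1` to 0 respect residues modulo `d`.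
  residue-next : ∀ d .{{_ : NonZero d}} → d ∣ n → ∀ v → residue d (next v) ≡ suc (toℕ (residue d v)) mod d
  residue-next d d∣n v = toℕ-injective (begin
    toℕ (toℕ (next v) mod d)           ≡⟨ toℕ-mod _ d ⟩
    toℕ (next v) % d                   ≡⟨ cong (_% d) (toℕ-mod _ n) ⟩
    suc (toℕ v) % n % d                ≡⟨ m∣n⇒o%n%m≡o%m d n (suc (toℕ v)) d∣n ⟩
    suc (toℕ v) % d                    ≡⟨ [1+m%n]%n≡[1+m]%n (toℕ v) d ⟨
    suc (toℕ v % d) % d                ≡⟨ cong (λ x → suc x % d) (toℕ-mod _ d) ⟨
    suc (toℕ (residue d v)) % d        ≡⟨ toℕ-mod _ d ⟨
    toℕ (suc (toℕ (residue d v)) mod d) ∎)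
    where open ≡-Reasoning

  module Even (2∣n : 2 ∣ n) where

    parity : Fin n → Fin 2
    parity = residue 2

    flip₂ : Fin 2 → Fin 2
    flip₂ r = suc (toℕ r) mod 2

    flip₂-free : ∀ r → r ≢ flip₂ r
    flip₂-free 0F ()
    flip₂-free 1F ()

    -- A step flips parity, also across the wrap since `n` is even. This supplies the condition
    -- `u ≢ v` in the adjacency of `C n`.
    next-free : ∀ v → v ≢ next v
    next-free v eq = flip₂-free (parity v) (trans (cong parity eq) (residue-next 2 2∣n v))

    adj-next : ∀ v → Adj (C n) v (next v)
    adj-next v = next-free v , inj₁ (sym (toℕ-mod (suc (toℕ v)) n))

    adj-prev : ∀ v → Adj (C n) v (prev v)
    adj-prev v = symm (C n) (subst (Adj (C n) (prev v)) (next-prev v) (adj-next (prev v)))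

    move : Fin 2 → Fin n → Fin n
    move 0F = next
    move 1F = prev

    -- Vertex 2i is matched with 2i + 1, so even vertices move forward and odd ones back.
    mate : Fin n → Fin n
    mate v = move (parity v) v

    mate-adj : ∀ v → Adj (C n) v (mate v)
    mate-adj v with parity v
    ... | 0F = adj-next v
    ... | 1F = adj-prev v

    mate-mate : ∀ v → mate (mate v) ≡ v
    mate-mate v with parity v in eq
    ... | 0F = trans (cong (λ r → move r (next v)) (trans (residue-next 2 2∣n v) (cong flip₂ eq))) (prev-next v)
    ... | 1F = trans (cong (λ r → move r (prev v)) parity-prev) (next-prev v)
      where
      flip₂-0F : ∀ r → flip₂ r ≡ 1F → r ≡ 0F
      flip₂-0F 0F _ = refl
      flip₂-0F 1F ()

      -- `residue-next` speaks of `next` only, so the parity of `prev v` is found by stepping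
      -- forward again to `v`.
      parity-prev : parity (prev v) ≡ 0F
      parity-prev = flip₂-0F _ (trans (sym (residue-next 2 2∣n (prev v))) (trans (cong parity (next-prev v)) eq))

    neighbour-mod-3 : 3 ∣ n → ∀ r v → residue 3 v ≢ r → ∃ λ u → residue 3 u ≡ r × Adj (C n) v u
    neighbour-mod-3 3∣n r v v≢r with next₃-cases (residue 3 v) r v≢r
    ... | inj₁ next≡r = next v , trans (residue-next 3 3∣n v) next≡r , adj-next v
    -- Likewise, `r` and the class of `prev v` both have the class of `v` as successor, and `next₃`
    -- is injective.
    ... | inj₂ r-next = prev v , next₃-injective _ r (trans next-r (sym r-next)) , adj-prev v
      where
      next-r : next₃ (residue 3 (prev v)) ≡ residue 3 v
      next-r = trans (sym (residue-next 3 3∣n (prev v))) (cong (residue 3) (next-prev v))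

-- Cycle factors

module Factor {n : ℕ} .{{_ : NonZero n}} (2∣n : 2 ∣ n) {G : Graph n} (G≅C : G ≅ C n) where

  open Cycle n
  open Even 2∣n
  open _≅_ G≅C renaming (bij to π)

  pull-adj : ∀ v {w} → Adj (C n) (π ⟨$⟩ʳ v) w → Adj G v (π ⟨$⟩ˡ w)
  pull-adj v {w} adj = Equivalence.from (preserve v (π ⟨$⟩ˡ w))
    (subst (Adj (C n) (π ⟨$⟩ʳ v)) (sym (inverseʳ π)) adj)

  match : Fin n → Fin n
  match v = π ⟨$⟩ˡ mate (π ⟨$⟩ʳ v)

  match-adj : ∀ v → Adj G v (match v)
  match-adj v = pull-adj v (mate-adj (π ⟨$⟩ʳ v))

  match-free : ∀ v → match v ≢ v
  match-free v eq = irrefl G (sym eq) (match-adj v)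

  match-match : ∀ v → match (match v) ≡ v
  match-match v = trans (cong (λ w → π ⟨$⟩ˡ mate w) (inverseʳ π))
                    (trans (cong (π ⟨$⟩ˡ_) (mate-mate (π ⟨$⟩ʳ v))) (inverseˡ π))

  class : Fin n → Fin 3
  class v = residue 3 (π ⟨$⟩ʳ v)

  -- A surviving vertex lies outside class `r` and so has a neighbour in it; that whole class is
  -- deleted, whatever `D` is.
  Escapes-∩∁ : 3 ∣ n → ∀ r (D : Subset n) → Escapes G (D ∩ ∁ (fibre class r))
  Escapes-∩∁ 3∣n r D v v∈ with neighbour-mod-3 3∣n r (π ⟨$⟩ʳ v)
                                   (x∈∁p⇒x∉p (proj₂ (x∈p∩q⁻ D _ v∈)) ∘ ∈-fibre⁺ class)
  ... | u , u≡r , adj = π ⟨$⟩ˡ u , u∉ , pull-adj v adj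
    where
    u∉ : π ⟨$⟩ˡ u ∉ D ∩ ∁ (fibre class r)
    u∉ u∈ = x∈∁p⇒x∉p (proj₂ (x∈p∩q⁻ D _ u∈)) (∈-fibre⁺ class (trans (cong (residue 3) (inverseʳ π)) u≡r))

  -- The three deletions keep twice the size of `D` in total, so the best of them keeps at least a
  -- third of that.
  thin : 3 ∣ n → (D : Subset n) → ∃ λ E → E ⊆ D × Escapes G E × 2 ℕ.* ∣ D ∣ ≤ℕ 3 ℕ.* ∣ E ∣
  thin 3∣n D with sum≤3*max (λ r → ∣ D ∩ ∁ (fibre class r) ∣)
  ... | r , sum≤ = D ∩ ∁ (fibre class r) , p∩q⊆p D _ , Escapes-∩∁ 3∣n r D ,
                   ℕ.≤-trans (ℕ.≤-reflexive (sym (∣∩∁fibre∣-sum class D))) sum≤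

∣∁p∣+∣p∣≡n : ∀ {n} (p : Subset n) → ∣ ∁ p ∣ ℕ.+ ∣ p ∣ ≡ n
∣∁p∣+∣p∣≡n p = trans (cong (ℕ._+ ∣ p ∣) (∣∁p∣≡n∸∣p∣ p)) (ℕ.m∸n+n≡m (∣p∣≤n p))

halve : ∀ {n} .{{_ : NonZero n}} → 2 ∣ n → (G H : Graph n) → G ≅ C n → H ≅ C n →
        ∃ λ D → Escapes G D × Escapes H D × n ≤ℕ 2 ℕ.* ∣ D ∣
halve {n} 2∣n G H G≅C H≅C = larger (ℕ.≤-total ∣ D ∣ ∣ ∁ D ∣)
  where
  module A = Factor 2∣n G≅C
  module B = Factor 2∣n H≅C
  open TwoMatchings A.match B.match A.match-match B.match-match A.match-free B.match-free

  D = tabulate colour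

  x+y≤2*y : ∀ {x y} → x ≤ℕ y → x ℕ.+ y ≤ℕ 2 ℕ.* y
  x+y≤2*y {x} {y} x≤y = ℕ.≤-trans (ℕ.+-monoˡ-≤ y x≤y) (ℕ.≤-reflexive (cong (y ℕ.+_) (sym (ℕ.+-identityʳ y))))

  n≡D+∁D : n ≡ ∣ D ∣ ℕ.+ ∣ ∁ D ∣
  n≡D+∁D = trans (sym (∣∁p∣+∣p∣≡n D)) (ℕ.+-comm ∣ ∁ D ∣ ∣ D ∣)

  -- The complement of `D` is given by the negated colouring, which alternates along the matchings
  -- as well.
  ∁-Escapes : (K : Graph n) (m : Fin n → Fin n) → (∀ v → Adj K v (m v)) →
              (∀ v → colour (m v) ≡ not (colour v)) → Escapes K (∁ D)
  ∁-Escapes K m adj alt = subst (Escapes K) (tabulate-∘ not colour)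
                            (Escapes-colour K m (not ∘ colour) adj (cong not ∘ alt))

  larger : ∣ D ∣ ≤ℕ ∣ ∁ D ∣ ⊎ ∣ ∁ D ∣ ≤ℕ ∣ D ∣ → ∃ λ D → Escapes G D × Escapes H D × n ≤ℕ 2 ℕ.* ∣ D ∣
  larger (inj₁ D≤∁D) = ∁ D , ∁-Escapes G A.match A.match-adj colour-a ,
                       ∁-Escapes H B.match B.match-adj colour-b ,
                       ℕ.≤-trans (ℕ.≤-reflexive n≡D+∁D) (x+y≤2*y D≤∁D)
  larger (inj₂ ∁D≤D) = D , Escapes-colour G A.match colour A.match-adj colour-a ,
                       Escapes-colour H B.match colour B.match-adj colour-b ,
                       ℕ.≤-trans (ℕ.≤-reflexive (sym (∣∁p∣+∣p∣≡n D))) (x+y≤2*y ∁D≤D)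

-- Rational bounds

-- Normalised fractions are compared through unnormalised ones with denominator 1; `mkℚᵘ` stores the
-- denominator minus one, hence the `0`.
fromℕ-mono-≤ : ∀ {m n} → m ≤ℕ n → fromℕ m ≤ fromℕ n
fromℕ-mono-≤ {m} {n} m≤n = ℚ.toℚᵘ-cancel-≤ (begin
  toℚᵘ (fromℕ m)     ≃⟨ ℚ.toℚᵘ-fromℚᵘ (ℚᵘ.mkℚᵘ (+ m) 0) ⟩
  ℚᵘ.mkℚᵘ (+ m) 0    ≤⟨ ℚᵘ.*≤* (ℤ.*-monoʳ-≤-nonNeg (+ 1) (+≤+ m≤n)) ⟩
  ℚᵘ.mkℚᵘ (+ n) 0    ≃⟨ ℚ.toℚᵘ-fromℚᵘ (ℚᵘ.mkℚᵘ (+ n) 0) ⟨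
  toℚᵘ (fromℕ n)     ∎)
  where open ℚᵘ.≤-Reasoning

fromℕ-+ : ∀ m n → fromℕ (m ℕ.+ n) ≡ fromℕ m + fromℕ n
fromℕ-+ m n = ℚ.toℚᵘ-injective (begin
  toℚᵘ (fromℕ (m ℕ.+ n))                  ≈⟨ ℚ.toℚᵘ-fromℚᵘ _ ⟩
  ℚᵘ.mkℚᵘ (+ (m ℕ.+ n)) 0                 ≈⟨ ℚᵘ.*≡* (cong (ℤ._* + 1) (sym (cong₂ ℤ._+_ (ℤ.*-identityʳ (+ m)) (ℤ.*-identityʳ (+ n))))) ⟩
  ℚᵘ.mkℚᵘ (+ m) 0 ℚᵘ.+ ℚᵘ.mkℚᵘ (+ n) 0    ≈⟨ ℚᵘ.+-cong (ℚ.toℚᵘ-fromℚᵘ (ℚᵘ.mkℚᵘ (+ m) 0)) (ℚ.toℚᵘ-fromℚᵘ (ℚᵘ.mkℚᵘ (+ n) 0)) ⟨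
  toℚᵘ (fromℕ m) ℚᵘ.+ toℚᵘ (fromℕ n)      ≈⟨ ℚ.toℚᵘ-homo-+ (fromℕ m) (fromℕ n) ⟨
  toℚᵘ (fromℕ m + fromℕ n)                ∎)
  where open ℚᵘ.≃-Reasoning

fromℕ-* : ∀ m n → fromℕ (m ℕ.* n) ≡ fromℕ m * fromℕ n
fromℕ-* m n = ℚ.toℚᵘ-injective (begin
  toℚᵘ (fromℕ (m ℕ.* n))                  ≈⟨ ℚ.toℚᵘ-fromℚᵘ _ ⟩
  ℚᵘ.mkℚᵘ (+ (m ℕ.* n)) 0                 ≈⟨ ℚᵘ.*≡* (cong (ℤ._* + 1) (ℤ.pos-* m n)) ⟩
  ℚᵘ.mkℚᵘ (+ m) 0 ℚᵘ.* ℚᵘ.mkℚᵘ (+ n) 0    ≈⟨ ℚᵘ.*-cong (ℚ.toℚᵘ-fromℚᵘ (ℚᵘ.mkℚᵘ (+ m) 0)) (ℚ.toℚᵘ-fromℚᵘ (ℚᵘ.mkℚᵘ (+ n) 0)) ⟨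
  toℚᵘ (fromℕ m) ℚᵘ.* toℚᵘ (fromℕ n)      ≈⟨ ℚ.toℚᵘ-homo-* (fromℕ m) (fromℕ n) ⟨
  toℚᵘ (fromℕ m * fromℕ n)                ∎)
  where open ℚᵘ.≃-Reasoning

⅔ : ℚ
⅔ = + 2 / 3

½-bound : ∀ m n → m ≤ℕ 2 ℕ.* n → ½ * fromℕ m ≤ fromℕ n
½-bound m n m≤2n = begin
  ½ * fromℕ m                 ≤⟨ ℚ.*-monoˡ-≤-nonNeg ½ (fromℕ-mono-≤ m≤2n) ⟩
  ½ * fromℕ (2 ℕ.* n)         ≡⟨ cong (½ *_) (fromℕ-* 2 n) ⟩
  -- `½ * fromℕ 2` computes to `1ℚ`.
  ½ * (fromℕ 2 * fromℕ n)     ≡⟨ ℚ.*-assoc ½ (fromℕ 2) (fromℕ n) ⟨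
  1ℚ * fromℕ n                ≡⟨ ℚ.*-identityˡ (fromℕ n) ⟩
  fromℕ n                     ∎
  where open ℚ.≤-Reasoning

⅔-bound : ∀ m n → 2 ℕ.* m ≤ℕ 3 ℕ.* n → ⅔ * fromℕ m ≤ fromℕ n
⅔-bound m n 2m≤3n = begin
  -- `⅔` and `⅓ * fromℕ 2` evaluate to the same rational, so associativity applies directly.
  ⅔ * fromℕ m                     ≡⟨ ℚ.*-assoc ⅓ (fromℕ 2) (fromℕ m) ⟩
  ⅓ * (fromℕ 2 * fromℕ m)         ≡⟨ cong (⅓ *_) (fromℕ-* 2 m) ⟨
  ⅓ * fromℕ (2 ℕ.* m)             ≤⟨ ℚ.*-monoˡ-≤-nonNeg ⅓ (fromℕ-mono-≤ 2m≤3n) ⟩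
  ⅓ * fromℕ (3 ℕ.* n)             ≡⟨ cong (⅓ *_) (fromℕ-* 3 n) ⟩
  ⅓ * (fromℕ 3 * fromℕ n)         ≡⟨ ℚ.*-assoc ⅓ (fromℕ 3) (fromℕ n) ⟨
  1ℚ * fromℕ n                    ≡⟨ ℚ.*-identityˡ (fromℕ n) ⟩
  fromℕ n                         ∎
  where
  open ℚ.≤-Reasoning
  ⅓ = + 1 / 3

-- The new factor `⅔` of the power is pulled to the front, leaving exactly the expression bounded by
-- `fromℕ d`.
⅔^-step : ∀ j n d e → ½ * ⅔ ^ j * fromℕ n ≤ fromℕ d → 2 ℕ.* d ≤ℕ 3 ℕ.* e →
          ½ * ⅔ ^ suc j * fromℕ n ≤ fromℕ e
⅔^-step j n d e bound 2d≤3e = begin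
  ½ * (⅔ * ⅔ ^ j) * fromℕ n     ≡⟨ cong (_* fromℕ n) (x∙yz≈y∙xz ½ ⅔ (⅔ ^ j)) ⟩
  ⅔ * (½ * ⅔ ^ j) * fromℕ n     ≡⟨ ℚ.*-assoc ⅔ (½ * ⅔ ^ j) (fromℕ n) ⟩
  ⅔ * (½ * ⅔ ^ j * fromℕ n)     ≤⟨ ℚ.*-monoˡ-≤-nonNeg ⅔ bound ⟩
  ⅔ * fromℕ d                   ≤⟨ ⅔-bound d e 2d≤3e ⟩
  fromℕ e                       ∎
  where
  open ℚ.≤-Reasoning
  open Algebra.Properties.CommutativeSemigroup
    (CommutativeMonoid.commutativeSemigroup ℚ.*-1-commutativeMonoid) using (x∙yz≈y∙xz)

x+y-y≡x : ∀ x y → x + y - y ≡ x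
x+y-y≡x x y = trans (ℚ.+-assoc x y (- y)) (trans (cong (_+_ x) (ℚ.+-inverseʳ y)) (ℚ.+-identityʳ x))

complement-bound : ∀ q s d n → s ℕ.+ d ≡ n → q * fromℕ n ≤ fromℕ d → fromℕ s ≤ (1ℚ - q) * fromℕ n
complement-bound q s d n s+d≡n bound = begin
  fromℕ s                             ≡⟨ x+y-y≡x (fromℕ s) (fromℕ d) ⟨
  fromℕ s + fromℕ d - fromℕ d         ≡⟨ cong (_- fromℕ d) (fromℕ-+ s d) ⟨
  fromℕ (s ℕ.+ d) - fromℕ d           ≡⟨ cong (λ m → fromℕ m - fromℕ d) s+d≡n ⟩
  fromℕ n - fromℕ d                   ≤⟨ ℚ.+-monoʳ-≤ (fromℕ n) (ℚ.neg-antimono-≤ bound) ⟩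
  fromℕ n - q * fromℕ n               ≡⟨ cong₂ _+_ (sym (ℚ.*-identityˡ (fromℕ n))) (ℚ.neg-distribˡ-* q (fromℕ n)) ⟩
  1ℚ * fromℕ n + (- q) * fromℕ n      ≡⟨ ℚ.*-distribʳ-+ (fromℕ n) 1ℚ (- q) ⟨
  (1ℚ - q) * fromℕ n                  ∎
  where open ℚ.≤-Reasoning

-- Adding factors one at a time, and return to dominating sets

largeEscaping : ∀ {n} .{{_ : NonZero n}} → 2 ∣ n → 3 ∣ n → ∀ j (F : Fin (2 ℕ.+ j) → Graph n) →
  (∀ i → F i ≅ C n) → ∃ λ D → (∀ i → Escapes (F i) D) × ½ * ⅔ ^ j * fromℕ n ≤ fromℕ ∣ D ∣
largeEscaping {n} 2∣n 3∣n zero F F≅C =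
  let D , esc₀ , esc₁ , n≤2D = halve 2∣n (F 0F) (F 1F) (F≅C 0F) (F≅C 1F)
  -- `½ * ⅔ ^ 0` computes to `½`, so `½-bound` fits.
  in D , ∀-cons esc₀ (∀-cons esc₁ λ ()) , ½-bound n ∣ D ∣ n≤2D
largeEscaping {n} 2∣n 3∣n (suc j) F F≅C =
  -- The first factor is set aside and then used to thin `D`; the other factors stay satisfied
  -- because `Escapes` passes to subsets.
  let D , esc , bound         = largeEscaping 2∣n 3∣n j (F ∘ suc) (F≅C ∘ suc)
      E , E⊆D , esc₀ , 2D≤3E = Factor.thin 2∣n (F≅C zero) 3∣n D
  in E , ∀-cons esc₀ (λ i → Escapes-⊆ (F (suc i)) E⊆D (esc i)) ,
     ⅔^-step j n ∣ D ∣ ∣ E ∣ bound 2D≤3E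

γsd-≤ : ∀ {k n} (F : Fin k → Graph n) (D : Subset n) → (∀ i → Escapes (F i) D) → γsd F ≤ℕ ∣ ∁ D ∣
γsd-≤ F D esc = proj₂ (proj₂ (simDomNumber F)) (∁ D) dominating
  where
  dominating : SimDominating F (∁ D)
  dominating i v v∉ with esc i v (x∉∁p⇒x∈p v∉)
  ... | u , u∉D , adj = u , x∉p⇒x∈∁p u∉D , adj

theorem23 : (k n : ℕ) .{{_ : NonZero n}} → 2 ≤ℕ k → 6 ∣ n →
    (F : Fin k → Graph n) → (∀ i → F i ≅ C n) →
    fromℕ (γsd F) ≤ (1ℚ - ½ * (+ 2 / 3) ^ (k ∸ 2)) * fromℕ n
theorem23 (suc (suc j)) n (s≤s (s≤s z≤n)) 6∣n F F≅C =
  -- `divides` takes the quotient: 3 shows that 2 divides 6, and 2 shows that 3 does.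
  let D , esc , bound = largeEscaping (∣-trans (divides 3 refl) 6∣n) (∣-trans (divides 2 refl) 6∣n) j F F≅C
  in ℚ.≤-trans (fromℕ-mono-≤ {γsd F} {∣ ∁ D ∣} (γsd-≤ F D esc))
       (complement-bound (½ * ⅔ ^ j) ∣ ∁ D ∣ ∣ D ∣ n (∣∁p∣+∣p∣≡n D) bound)
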